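{- For every integer $l\ge 1$, $$\mathcal B_{l,3}=F_{l+3},$$ where $\mathcal B_{l,3}$ is the common value $\mathcal B^{(1)}_{l,3}=\mathcal B^{(2)}_{l,3}$ of the numbers of brick-wall lattice paths of the first and of the second type connecting the left and right sides of the rectangle $[0,l-1]\times[0,2]$.
   Context: The Fibonacci sequence is $F_0=0$, $F_1=1$, $F_n=F_{n-1}+F_{n-2}$ for $n\ge2$. A point $(a,b)\in\mathbf Z\times\mathbf Z$ is even (odd) if $|a|+|b|$ is even (odd). A brick-wall lattice path of the first type is a finite sequence of points of $\mathbf Z\times\mathbf Z$ in which each consecutive step is either the horizontal step $(1,0)$ (allowed from any point), or the step $(0,1)$ taken from an even point, or the step $(0,-1)$ taken from an odd point. A brick-wall lattice path of the second type is defined in the same way with the steps $(1,0)$ from any point, $(0,1)$ from an odd point, $(0,-1)$ from an even point. Paths visit no point more than once; the empty path (a single point) is allowed. Let $\mathcal R=[0,l-1]\times[0,w-1]$, here with $w=3$. For $t\in\{1,2\}$, $\mathcal B^{(t)}_{l,w}$ is the number of brick-wall lattice paths of type $t$ (type 1 = first, type 2 = second) starting at some point $(0,\alpha)$ and ending at some point $(l-1,\beta)$, with $\alpha,\beta\in\{0,\dots,w-1\}$, staying inside $\mathcal R$ and using no vertical step along the left side $x=0$ (vertical steps along the right side $x=l-1$ are allowed when $l\ge2$). For $l=1$ the rectangle is a degenerate vertical segment and only the $w$ empty paths are counted. -}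

module Defs where

open import Data.Nat.Base as ℕ using (ℕ; zero; suc)
open import Data.Nat.Divisibility using (_∣_)
open import Data.Integer.Base using (ℤ; +_; 0ℤ; 1ℤ; ∣_∣; _+_; _-_; _≤_)
open import Data.Fin.Base using (Fin; toℕ)
open import Data.List.Base using (List; length; head; last)
open import Data.List.Membership.Propositional using (_∈_)
open import Data.List.Membership.Propositional.Properties.WithK using (unique∧set⇒bag)
open import Data.List.Relation.Binary.BagAndSetEquality using (∼bag⇒↭)
open import Data.List.Relation.Binary.Permutation.Propositional.Properties using (↭-length)
open import Data.List.Relation.Unary.All using (All)
open import Data.List.Relation.Unary.Linked using (Linked)
open import Data.List.Relation.Unary.Unique.Propositional using (Unique)
open import Data.Maybe.Base using (just)
open import Data.Product.Base using (_×_; _,_; ∃-syntax)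
open import Data.Sum.Base using (_⊎_)
open import Function.Bundles using (_⇔_)
open import Function.Properties.Equivalence using () renaming (sym to ⇔-sym; trans to ⇔-trans)
open import Relation.Binary.PropositionalEquality using (_≡_; sym; trans)
open import Relation.Nullary.Negation.Core using (¬_)

F : ℕ → ℕ
F zero          = 0
F (suc zero)    = 1
F (suc (suc n)) = F (suc n) ℕ.+ F n

Point : Set
Point = ℤ × ℤ

Even Odd : Point → Set
Even (a , b) = 2 ∣ (∣ a ∣ ℕ.+ ∣ b ∣)
Odd p        = ¬ Even p

Right Up Down : Point → Point → Set
Right (a , b) q = q ≡ (a + 1ℤ , b)
Up    (a , b) q = q ≡ (a , b + 1ℤ)
Down  (a , b) q = q ≡ (a , b - 1ℤ)

data PathType : Set where
  first second : PathType

Step : PathType → Point → Point → Set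
Step first  p q = Right p q ⊎ (Up p q × Even p) ⊎ (Down p q × Odd p)
Step second p q = Right p q ⊎ (Up p q × Odd p) ⊎ (Down p q × Even p)

-- A path is the list of points it visits, in order. The empty list is excluded
-- by the endpoint conditions of `Connects`; the empty path is a one-point list.
BrickWallPath : PathType → List Point → Set
BrickWallPath t ps = Linked (Step t) ps × Unique ps

InRectangle : (l w : ℕ) → Point → Set
InRectangle l w (a , b) =
  (0ℤ ≤ a × a ≤ + l - 1ℤ) × (0ℤ ≤ b × b ≤ + w - 1ℤ)

OnLeftSide : Point → Set
OnLeftSide (a , _) = a ≡ 0ℤ

VerticalOnLeftSide : Point → Point → Set
VerticalOnLeftSide p q = (Up p q ⊎ Down p q) × OnLeftSide p

-- For l = 1 the ban on vertical steps along x = 0 leaves exactly the w empty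
-- paths, so the degenerate rectangle needs no separate clause.
Connects : PathType → (l w : ℕ) → List Point → Set
Connects t l w ps =
    BrickWallPath t ps
  × (∃[ α ] head ps ≡ just (0ℤ , + toℕ {w} α))
  × (∃[ β ] last ps ≡ just (+ l - 1ℤ , + toℕ {w} β))
  × All (InRectangle l w) ps
  × Linked (λ p q → ¬ VerticalOnLeftSide p q) ps

-- There are exactly n elements satisfying P: some duplicate-free list of
-- length n consists of precisely those elements.
HasCardinality : {A : Set} → (A → Set) → ℕ → Set
HasCardinality {A} P n =
  ∃[ xs ] Unique xs × (∀ (x : A) → x ∈ xs ⇔ P x) × length xs ≡ n

HasCardinality-unique : {A : Set} {P : A → Set} {m n : ℕ} →
  HasCardinality P m → HasCardinality P n → m ≡ n
HasCardinality-unique (_ , xs! , xs⇔P , |xs|≡m) (_ , ys! , ys⇔P , |ys|≡n) =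
  trans (sym |xs|≡m) (trans (↭-length (∼bag⇒↭ (unique∧set⇒bag xs! ys!
    (λ {x} → ⇔-trans (xs⇔P x) (⇔-sym (ys⇔P x)))))) |ys|≡n)

-- The number 𝓑⁽ᵗ⁾_{l,w} is encoded as the relation "𝓑⁽ᵗ⁾_{l,w} = n", which is
-- functional in n by HasCardinality-unique.
𝓑[_]_,_≔_ : PathType → (l w n : ℕ) → Set
𝓑[ t ] l , w ≔ n = HasCardinality (Connects t l w) n

{-# OPTIONS --safe #-}
-- A column of the rectangle has three points. Two vertically adjacent ones are
-- joined by a vertical step in each direction, and the third one is isolated;
-- the joined pair alternates between {0,1} and {1,2} from column to column.
-- Hence a path visits one or two points of each column and is determined by
-- the heights at which it leaves the columns. The number of continuations from
-- a point is a Fibonacci number, whose index only depends on the number of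
-- remaining columns and on whether the point is isolated in its column, and
-- the recurrence of F is the alternative between going straight on and using
-- the vertical step first.
module Submission where

open import Defs
open import Data.Nat.Base using (ℕ; _+_; _≥_)
open import Data.Product.Base using (_×_)

open import Data.Nat.Base using (zero; suc; s≤s; z≤n; _≤_)
open import Data.Nat.Properties
  using (+-suc; +-comm; +-identityʳ; m≤m+n; ≤-refl; 1+n≰n; m+1+n≢m; 1+n≢n; n≤1+n)
open import Data.Nat.Divisibility using (_∣_; ∣1⇒≡1; ∣m+n∣m⇒∣n; n∣n; ∣m∣n⇒∣m+n; _∣0)
open import Data.Nat.Solver using (module +-*-Solver)
open +-*-Solver using (solve; _:+_; _:=_)
open import Data.Integer.Base as ℤ using (+_)
import Data.Integer.Properties as ℤ
open import Data.Fin.Base using (Fin; toℕ)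
open import Data.Fin.Patterns using (0F; 1F; 2F)
open import Data.Fin.Properties using (toℕ-injective; toℕ≤pred[n])
open import Data.List.Base using (List; []; _∷_; _++_; map; last)
open import Data.List.Properties using (length-++; length-map; ∷-injectiveˡ; ∷-injectiveʳ)
open import Data.List.Membership.Propositional.Properties
  using (∈-map⁺; ∈-map⁻; ∈-++⁺ˡ; ∈-++⁺ʳ; ∈-++⁻)
open import Data.List.Relation.Unary.Any using (here; there)
open import Data.List.Relation.Unary.All as All using (All; []; _∷_)
open import Data.List.Relation.Unary.AllPairs using ([]; _∷_)
open import Data.List.Relation.Unary.Linked using (Linked; []; [-]; _∷_)
open import Data.List.Relation.Unary.Unique.Propositional using (Unique)
import Data.List.Relation.Unary.Unique.Propositional.Properties as Unique
open import Data.Maybe.Base using (Maybe; just; nothing)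
open import Data.Maybe.Properties using (just-injective)
open import Data.Product.Base using (_,_; proj₁; proj₂; ∃-syntax)
open import Data.Sum.Base using (_⊎_; inj₁; inj₂; [_,_]′)
open import Function.Base using (_∘_)
open import Function.Bundles using (_⇔_; mk⇔; Equivalence)
open import Function.Definitions using (Injective)
open import Function.Properties.Equivalence using () renaming (trans to ⇔-trans)
open import Relation.Binary.PropositionalEquality
open import Relation.Nullary using (¬_; contradiction)
open import Relation.Unary using (∅; _∪_)

private
  variable
    A B : Set
    P Q : A → Set
    m n x : ℕ

-- Cardinalities

Image : (A → B) → (A → Set) → B → Set
Image f P y = ∃[ x ] P x × y ≡ f x

HasCardinality-⇔ : (∀ x → P x ⇔ Q x) → HasCardinality P n → HasCardinality Q n
HasCardinality-⇔ P⇔Q (xs , xs! , xs⇔P , |xs|) =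
  xs , xs! , (λ x → ⇔-trans (xs⇔P x) (P⇔Q x)) , |xs|

HasCardinality-∅ : HasCardinality {A} ∅ 0
HasCardinality-∅ = [] , [] , (λ _ → mk⇔ (λ ()) (λ ())) , refl

HasCardinality-singleton : (a : A) → HasCardinality (_≡ a) 1
HasCardinality-singleton a =
  a ∷ [] , [] ∷ [] , (λ x → mk⇔ (λ { (here eq) → eq ; (there ()) }) here) , refl

HasCardinality-∪ : (∀ {x} → P x → ¬ Q x) →
  HasCardinality P m → HasCardinality Q n → HasCardinality (P ∪ Q) (m + n)
HasCardinality-∪ disjoint (xs , xs! , xs⇔P , refl) (ys , ys! , ys⇔Q , refl) =
  xs ++ ys ,
  Unique.++⁺ xs! ys! (λ (∈xs , ∈ys) →
    disjoint (Equivalence.to (xs⇔P _) ∈xs) (Equivalence.to (ys⇔Q _) ∈ys)) ,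
  (λ x → mk⇔
    ([ inj₁ ∘ Equivalence.to (xs⇔P x) , inj₂ ∘ Equivalence.to (ys⇔Q x) ]′ ∘ ∈-++⁻ xs)
    [ ∈-++⁺ˡ ∘ Equivalence.from (xs⇔P x) , ∈-++⁺ʳ xs ∘ Equivalence.from (ys⇔Q x) ]′) ,
  length-++ xs

HasCardinality-Image : (f : A → B) → Injective _≡_ _≡_ f →
  HasCardinality P n → HasCardinality (Image f P) n
HasCardinality-Image f f-inj (xs , xs! , xs⇔P , refl) =
  map f xs ,
  Unique.map⁺ f-inj xs! ,
  (λ y → mk⇔
    (λ y∈ → let (x , x∈ , y≡) = ∈-map⁻ f y∈ in x , Equivalence.to (xs⇔P x) x∈ , y≡)
    (λ { (x , Px , refl) → ∈-map⁺ f (Equivalence.from (xs⇔P x) Px) })) ,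
  length-map f xs

-- Columns

data Heading : Set where
  up down : Heading

flip : Heading → Heading
flip up   = down
flip down = up

-- Restates the parity rule of `Step` as one heading per point. The two path types then differ only
-- in the heading of the origin, and a single argument counts both.
Heads : PathType → Heading → Point → Set
Heads first  up   = Even
Heads first  down = Odd
Heads second up   = Odd
Heads second down = Even

Move : Heading → Point → Point → Set
Move up   = Up
Move down = Down

pt : ℕ → Fin 3 → Point
pt x b = + x , + toℕ b

pt-injectiveʳ : ∀ {x y b c} → pt x b ≡ pt y c → b ≡ c
pt-injectiveʳ = toℕ-injective ∘ ℤ.+-injective ∘ cong proj₂

climb : Heading → Fin 3 → Maybe (Fin 3)
climb up   0F = just 1F
climb up   1F = just 2F
climb up   2F = nothing
climb down 0F = nothing
climb down 1F = just 0F
climb down 2F = just 1F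

-- Throughout, φ is the heading of the bottom point of the column at hand.
heading : Heading → Fin 3 → Heading
heading φ 0F = φ
heading φ 1F = flip φ
heading φ 2F = flip (flip φ)

-- For `up` this swaps heights 0 and 1 and isolates 2; for `down` it swaps 1 and 2 and isolates 0.
partner : Heading → Fin 3 → Maybe (Fin 3)
partner φ b = climb (heading φ b) b

partner-irreflexive : ∀ φ b {b′} → partner φ b ≡ just b′ → b ≢ b′
partner-irreflexive up   0F refl ()
partner-irreflexive up   1F refl ()
partner-irreflexive up   2F ()
partner-irreflexive down 0F ()
partner-irreflexive down 1F refl ()
partner-irreflexive down 2F refl ()

-- Rules out a second vertical step in a column: it would lead back to the point just left.
partner-involutive : ∀ φ b {b′ b″} →
  partner φ b ≡ just b′ → partner φ b′ ≡ just b″ → b″ ≡ b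
partner-involutive up   0F refl refl = refl
partner-involutive up   1F refl refl = refl
partner-involutive up   2F ()
partner-involutive down 0F ()
partner-involutive down 1F refl refl = refl
partner-involutive down 2F refl refl = refl

2∣n⇒2∤1+n : 2 ∣ n → ¬ 2 ∣ suc n
2∣n⇒2∤1+n {n} 2∣n 2∣1+n
  with () ← ∣1⇒≡1 (∣m+n∣m⇒∣n (subst (2 ∣_) (+-comm 1 n) 2∣1+n) 2∣n)

2∤n⇒2∣1+n : ∀ n → ¬ 2 ∣ n → 2 ∣ suc n
2∤n⇒2∣1+n zero          2∤0 = contradiction (2 ∣0) 2∤0
2∤n⇒2∣1+n (suc zero)    _   = n∣n
2∤n⇒2∣1+n (suc (suc n)) 2∤  =
  ∣m∣n⇒∣m+n n∣n (2∤n⇒2∣1+n n (2∤ ∘ ∣m∣n⇒∣m+n n∣n))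

Heads-unique : ∀ t d e {p} → Heads t d p → Heads t e p → d ≡ e
Heads-unique t      up   up   _ _ = refl
Heads-unique t      down down _ _ = refl
Heads-unique first  up   down h k = contradiction h k
Heads-unique first  down up   h k = contradiction k h
Heads-unique second up   down h k = contradiction k h
Heads-unique second down up   h k = contradiction h k

Heads-right : ∀ t φ x b → Heads t φ (+ x , + b) → Heads t (flip φ) (+ suc x , + b)
Heads-right first  up   x b h = 2∣n⇒2∤1+n h
Heads-right first  down x b h = 2∤n⇒2∣1+n (x + b) h
Heads-right second up   x b h = 2∤n⇒2∣1+n (x + b) h
Heads-right second down x b h = 2∣n⇒2∤1+n h

-- Only the sum of the coordinates matters.
Heads-shift : ∀ t φ x b → Heads t φ (+ suc x , + b) → Heads t φ (+ x , + suc b)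
Heads-shift first  up   x b = subst (2 ∣_) (sym (+-suc x b))
Heads-shift first  down x b = subst (λ k → ¬ 2 ∣ k) (sym (+-suc x b))
Heads-shift second up   x b = subst (λ k → ¬ 2 ∣ k) (sym (+-suc x b))
Heads-shift second down x b = subst (2 ∣_) (sym (+-suc x b))

Heads-above : ∀ t φ x b → Heads t φ (+ x , + b) → Heads t (flip φ) (+ x , + suc b)
Heads-above t φ x b = Heads-shift t (flip φ) x b ∘ Heads-right t φ x b

Heads-heading : ∀ t φ x b → Heads t φ (pt x 0F) → Heads t (heading φ b) (pt x b)
Heads-heading t φ x 0F h = h
Heads-heading t φ x 1F h = Heads-above t φ x 0 h
Heads-heading t φ x 2F h = Heads-above t (flip φ) x 1 (Heads-above t φ x 0 h)

Step-cases : ∀ t {p q} → Step t p q → Right p q ⊎ (∃[ d ] Heads t d p × Move d p q)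
Step-cases first  (inj₁ r)              = inj₁ r
Step-cases first  (inj₂ (inj₁ (m , h))) = inj₂ (up , h , m)
Step-cases first  (inj₂ (inj₂ (m , h))) = inj₂ (down , h , m)
Step-cases second (inj₁ r)              = inj₁ r
Step-cases second (inj₂ (inj₁ (m , h))) = inj₂ (up , h , m)
Step-cases second (inj₂ (inj₂ (m , h))) = inj₂ (down , h , m)

right-step : ∀ t {p q} → Right p q → Step t p q
right-step first  = inj₁
right-step second = inj₁

vertical-step : ∀ t d {p q} → Heads t d p → Move d p q → Step t p q
vertical-step first  up   h m = inj₂ (inj₁ (m , h))
vertical-step first  down h m = inj₂ (inj₂ (m , h))
vertical-step second up   h m = inj₂ (inj₁ (m , h))
vertical-step second down h m = inj₂ (inj₂ (m , h))

Right-pt : ∀ x b → Right (pt x b) (pt (suc x) b)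
Right-pt x b = cong (λ k → + k , + toℕ b) (+-comm 1 x)

-- The height bounds on `q` exclude the two cases in which `climb` is `nothing`.
Move-climb : ∀ d {x} b {q l} → Move d (pt x b) q → InRectangle l 3 q →
  ∃[ b′ ] climb d b ≡ just b′ × q ≡ pt x b′
Move-climb up   0F refl _ = 1F , refl , refl
Move-climb up   1F refl _ = 2F , refl , refl
Move-climb up   2F refl (_ , _ , ℤ.+≤+ (s≤s (s≤s ())))
Move-climb down 0F refl (_ , () , _)
Move-climb down 1F refl _ = 0F , refl , refl
Move-climb down 2F refl _ = 1F , refl , refl

climb-Move : ∀ d {x} b {b′} → climb d b ≡ just b′ → Move d (pt x b) (pt x b′)
climb-Move up   0F refl = refl
climb-Move up   1F refl = refl
climb-Move up   2F ()
climb-Move down 0F ()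
climb-Move down 1F refl = refl
climb-Move down 2F refl = refl

-- Parity gives each point a single heading, so a vertical step follows `heading φ b`; staying
-- within heights 0 to 2 makes its target the partner.
Step⇒right⊎partner : ∀ t φ {x} b {q l} → Heads t φ (pt x 0F) →
  Step t (pt x b) q → InRectangle l 3 q →
  q ≡ pt (suc x) b ⊎ (∃[ b′ ] partner φ b ≡ just b′ × q ≡ pt x b′)
Step⇒right⊎partner t φ {x} b {l = l} h s q∈ with Step-cases t s
... | inj₁ refl = inj₁ (sym (Right-pt x b))
... | inj₂ (d , hd , mv)
  rewrite Heads-unique t (heading φ b) d (Heads-heading t φ x b h) hd
  = inj₂ (Move-climb d b {l = l} mv q∈)

-- Paths as sequences of columns

-- Leaving and Entering hold of the lists qs for which pt x b ∷ qs is a path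
-- through n further columns; a path entering column x may still move vertically
-- in it, a path leaving column x may not.
Leaving Entering : Heading → (x : ℕ) → Fin 3 → (n : ℕ) → List Point → Set
Turning : Heading → (x : ℕ) → Maybe (Fin 3) → (n : ℕ) → List Point → Set
Leaving φ x b zero    = _≡ []
Leaving φ x b (suc n) = Image (pt (suc x) b ∷_) (Entering (flip φ) (suc x) b n)
Entering φ x b n      = Leaving φ x b n ∪ Turning φ x (partner φ b) n
Turning φ x (just b) n = Image (pt x b ∷_) (Leaving φ x b n)
Turning φ x nothing  n = ∅

-- Fibonacci counts of the continuations

fib : Maybe (Fin 3) → ℕ → ℕ
fib (just _) n = F (suc n)
fib nothing  n = F n

fib-1 : ∀ b → fib b 1 ≡ 1
fib-1 (just _) = refl
fib-1 nothing  = refl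

-- What matters is whether `b` is isolated in the next column, hence `flip φ`. The index is chosen
-- so that `#Leaving φ b (suc n)` is `#Entering (flip φ) b n` by computation.
#Leaving : Heading → Fin 3 → ℕ → ℕ
#Leaving φ b n = fib (partner (flip φ) b) (suc n)

#Turning : Heading → Maybe (Fin 3) → ℕ → ℕ
#Turning φ (just b) n = #Leaving φ b n
#Turning φ nothing  n = 0

#Entering : Heading → Fin 3 → ℕ → ℕ
#Entering φ b n = fib (partner φ b) (suc (suc n))

-- Of a joined pair, the middle point is joined again in the next column and the outer one is
-- isolated there, giving `F (n + 2)` and `F (n + 1)` in some order. An isolated point becomes
-- joined, giving `F (n + 2)` alone.
#Leaving+#Turning : ∀ φ b n → #Leaving φ b n + #Turning φ (partner φ b) n ≡ #Entering φ b n
#Leaving+#Turning up   0F n = +-comm (F (suc n)) (F (suc (suc n)))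
#Leaving+#Turning up   1F n = refl
#Leaving+#Turning up   2F n = +-identityʳ (F (suc (suc n)))
#Leaving+#Turning down 0F n = +-identityʳ (F (suc (suc n)))
#Leaving+#Turning down 1F n = refl
#Leaving+#Turning down 2F n = +-comm (F (suc n)) (F (suc (suc n)))

-- A turning list begins in column `x`; a leaving list is empty or begins in column `x + 1`.
Leaving-Turning-disjoint : ∀ φ {x b} b′ n {qs} → Leaving φ x b n qs → ¬ Turning φ x b′ n qs
Leaving-Turning-disjoint φ (just _) zero    refl           (_ , _ , ())
Leaving-Turning-disjoint φ (just _) (suc n) (_ , _ , refl) (_ , _ , eq) =
  1+n≢n (ℤ.+-injective (cong proj₁ (∷-injectiveˡ eq)))

Leaving-card : ∀ φ x b n → HasCardinality (Leaving φ x b n) (#Leaving φ b n)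
Entering-card : ∀ φ x b n → HasCardinality (Entering φ x b n) (#Entering φ b n)
Turning-card : ∀ φ x b n → HasCardinality (Turning φ x b n) (#Turning φ b n)
Leaving-card φ x b zero =
  -- The single empty continuation fits both cases of `fib` because `F 1` and `F 2` are both 1.
  subst (HasCardinality _) (sym (fib-1 (partner (flip φ) b))) (HasCardinality-singleton [])
Leaving-card φ x b (suc n) =
  HasCardinality-Image (pt (suc x) b ∷_) ∷-injectiveʳ (Entering-card (flip φ) (suc x) b n)
Entering-card φ x b n = subst (HasCardinality _) (#Leaving+#Turning φ b n)
  (HasCardinality-∪ (Leaving-Turning-disjoint φ (partner φ b) n)
    (Leaving-card φ x b n) (Turning-card φ x (partner φ b) n))
Turning-card φ x (just b) n =
  HasCardinality-Image (pt x b ∷_) ∷-injectiveʳ (Leaving-card φ x b n)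
Turning-card φ x nothing n = HasCardinality-∅

-- Taking `Leaving` instead of `Entering` in column 0 encodes the ban on vertical steps along the
-- left side.
Starting : Heading → (b : Fin 3) → (n : ℕ) → List Point → Set
Starting φ b n = Image (pt 0 b ∷_) (Leaving φ 0 b n)

Starting-disjoint : ∀ φ n {b c ps} → b ≢ c → Starting φ b n ps → ¬ Starting φ c n ps
Starting-disjoint φ n b≢c (_ , _ , refl) (_ , _ , eq) = b≢c (pt-injectiveʳ (∷-injectiveˡ eq))

∃Starting-card : ∀ φ n →
  HasCardinality (λ ps → ∃[ b ] Starting φ b n ps)
    (#Leaving φ 0F n + (#Leaving φ 1F n + #Leaving φ 2F n))
∃Starting-card φ n = HasCardinality-⇔
  (λ _ → mk⇔
    [ (0F ,_) , [ (1F ,_) , (2F ,_) ]′ ]′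
    (λ (b , s) → split b s))
  (HasCardinality-∪
    (λ s → [ Starting-disjoint φ n (λ ()) s , Starting-disjoint φ n (λ ()) s ]′)
    (card 0F)
    (HasCardinality-∪ (Starting-disjoint φ n (λ ())) (card 1F) (card 2F)))
  where
  split : ∀ b {ps} → Starting φ b n ps →
    (Starting φ 0F n ∪ (Starting φ 1F n ∪ Starting φ 2F n)) ps
  split 0F s = inj₁ s
  split 1F s = inj₂ (inj₁ s)
  split 2F s = inj₂ (inj₂ s)

  card : ∀ b → HasCardinality (Starting φ b n) (#Leaving φ b n)
  card b = HasCardinality-Image (pt 0 b ∷_) ∷-injectiveʳ (Leaving-card φ 0 b n)

-- Two heights are joined in the next column and one is isolated, so the sum is `F (n + 2)` twice
-- plus `F (n + 1)`. Commuting `n + 3` lets `F` unfold to these terms.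
#Starting : ∀ φ n → #Leaving φ 0F n + (#Leaving φ 1F n + #Leaving φ 2F n) ≡ F (suc n + 3)
#Starting φ n rewrite +-comm n 3 with φ
... | up   = solve 2 (λ a b → a :+ (b :+ b) := b :+ a :+ b) refl (F (suc n)) (F (suc (suc n)))
... | down = solve 2 (λ a b → b :+ (b :+ a) := b :+ a :+ b) refl (F (suc n)) (F (suc (suc n)))

-- Brick-wall paths

-- `Connects` for length `m + 1` without its start and left-side conditions, so that it passes to
-- nonempty tails. Below, `x + n ≡ m` says that `n` columns remain to the right of column `x`.
Valid : PathType → ℕ → Point → List Point → Set
Valid t m p qs =
    BrickWallPath t (p ∷ qs)
  × All (InRectangle (suc m) 3) (p ∷ qs)
  × (∃[ β ] last (p ∷ qs) ≡ just (+ m , + toℕ {3} β))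

Valid-∷ : ∀ {t p q qs} → Step t p q → InRectangle (suc m) 3 p → All (p ≢_) (q ∷ qs) →
  Valid t m q qs → Valid t m p (q ∷ qs)
Valid-∷ s p∈ p∉ ((ss , qs!) , qs∈ , end) = (s ∷ ss , p∉ ∷ qs!) , p∈ ∷ qs∈ , end

Valid-tail : ∀ {t p q qs} → Valid t m p (q ∷ qs) → Valid t m q qs
Valid-tail ((_ ∷ ss , _ ∷ qs!) , _ ∷ qs∈ , end) = (ss , qs!) , qs∈ , end

AtLeast : ℕ → Point → Set
AtLeast x (a , _) = + x ℤ.≤ a

pt-AtLeast : ∀ x b → AtLeast x (pt x b)
pt-AtLeast x b = ℤ.+≤+ ≤-refl

AtLeast-weaken : ∀ {p} → AtLeast (suc x) p → AtLeast x p
AtLeast-weaken = ℤ.≤-trans (ℤ.+≤+ (n≤1+n _))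

AtLeast⇒≢ : ∀ {b p} → AtLeast (suc x) p → pt x b ≢ p
AtLeast⇒≢ (ℤ.+≤+ x<x) refl = 1+n≰n x<x

pt∈Rectangle : ∀ x b n → x + n ≡ m → InRectangle (suc m) 3 (pt x b)
pt∈Rectangle x b n refl =
  (ℤ.+≤+ z≤n , ℤ.+≤+ (m≤m+n x n)) , (ℤ.+≤+ z≤n , ℤ.+≤+ (toℕ≤pred[n] b))

-- The lower bound on abscissas strengthens the induction: it shows that a point put in front is not
-- visited again.
Leaving⇒Valid : ∀ t φ x b n {qs} → Heads t φ (pt x 0F) → x + n ≡ m →
  Leaving φ x b n qs → Valid t m (pt x b) qs × All (AtLeast (suc x)) qs
Entering⇒Valid : ∀ t φ x b n {qs} → Heads t φ (pt x 0F) → x + n ≡ m →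
  Entering φ x b n qs → Valid t m (pt x b) qs × All (AtLeast x) qs
Leaving⇒Valid t φ x b zero h eq refl =
  (([-] , [] ∷ []) , pt∈Rectangle x b 0 eq ∷ [] ,
    b , cong (λ k → just (+ k , + toℕ b)) (trans (sym (+-identityʳ x)) eq)) ,
  []
Leaving⇒Valid t φ x b (suc n) h eq (_ , e , refl) =
  let v , qs≥ = Entering⇒Valid t (flip φ) (suc x) b n (Heads-right t φ x 0 h)
                  (trans (sym (+-suc x n)) eq) e
      ≥ = pt-AtLeast (suc x) b ∷ qs≥
  in Valid-∷ (right-step t (Right-pt x b)) (pt∈Rectangle x b (suc n) eq)
       (All.map AtLeast⇒≢ ≥) v ,
     ≥
Entering⇒Valid t φ x b n h eq (inj₁ l) =
  let v , qs≥ = Leaving⇒Valid t φ x b n h eq l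
  in v , All.map (λ {p} → AtLeast-weaken {p = p}) qs≥
Entering⇒Valid t φ x b n h eq (inj₂ r) with partner φ b in b↔b′
Entering⇒Valid t φ x b n h eq (inj₂ (_ , l , refl)) | just b′ =
  let v , qs≥ = Leaving⇒Valid t φ x b′ n h eq l
  in Valid-∷ (vertical-step t (heading φ b) (Heads-heading t φ x b h)
                (climb-Move (heading φ b) b b↔b′))
       (pt∈Rectangle x b n eq)
       (partner-irreflexive φ b b↔b′ ∘ pt-injectiveʳ ∷ All.map AtLeast⇒≢ qs≥) v ,
     pt-AtLeast x b′ ∷ All.map (λ {p} → AtLeast-weaken {p = p}) qs≥

-- The hypothesis that `qs` does not begin with the partner is met in three ways: by the ban in
-- column 0, by non-repetition after a turn, and by the abscissa when the first step goes right.
Valid⇒Leaving : ∀ t φ x b n qs → Heads t φ (pt x 0F) → x + n ≡ m →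
  (∀ {b′ rs} → partner φ b ≡ just b′ → qs ≢ pt x b′ ∷ rs) →
  Valid t m (pt x b) qs → Leaving φ x b n qs
Valid⇒Entering : ∀ t φ x b n qs → Heads t φ (pt x 0F) → x + n ≡ m →
  Valid t m (pt x b) qs → Entering φ x b n qs
Valid⇒Leaving t φ x b zero [] h eq _ v = refl
-- The path would end in column `x`, but its last column is `x + n + 1`.
Valid⇒Leaving t φ x b (suc n) [] h eq _ (_ , _ , _ , end) =
  contradiction (trans eq (sym (ℤ.+-injective (cong proj₁ (just-injective end))))) (m+1+n≢m x)
Valid⇒Leaving {m} t φ x b n (q ∷ qs) h eq ¬turn v@((s ∷ _ , _) , _ ∷ q∈ ∷ _ , _)
  with Step⇒right⊎partner t φ b {l = suc m} h s q∈
... | inj₂ (_ , b↔b′ , refl) = contradiction refl (¬turn b↔b′)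
-- Here `x` is the last abscissa `m`, so a right step would leave the rectangle.
Valid⇒Leaving t φ x b zero (_ ∷ qs) h eq ¬turn (_ , _ ∷ ((_ , ℤ.+≤+ x<m) , _) ∷ _ , _)
  | inj₁ refl =
  contradiction (subst (suc x ≤_) (trans (sym eq) (+-identityʳ x)) x<m) 1+n≰n
Valid⇒Leaving t φ x b (suc n) (_ ∷ qs) h eq ¬turn v | inj₁ refl =
  qs ,
  Valid⇒Entering t (flip φ) (suc x) b n qs (Heads-right t φ x 0 h)
    (trans (sym (+-suc x n)) eq) (Valid-tail v) ,
  refl
Valid⇒Entering t φ x b n [] h eq v = inj₁ (Valid⇒Leaving t φ x b n [] h eq (λ _ ()) v)
Valid⇒Entering {m} t φ x b n (q ∷ qs) h eq v@((s ∷ _ , (_ ∷ p∉qs) ∷ _) , _ ∷ q∈ ∷ _ , _)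
  with Step⇒right⊎partner t φ b {l = suc m} h s q∈
... | inj₁ refl =
  inj₁ (Valid⇒Leaving t φ x b n (q ∷ qs) h eq
    (λ _ → 1+n≢n ∘ ℤ.+-injective ∘ cong proj₁ ∘ ∷-injectiveˡ) v)
... | inj₂ (b′ , b↔b′ , refl) rewrite b↔b′ =
  inj₂ (qs , Valid⇒Leaving t φ x b′ n qs h eq ¬return (Valid-tail v) , refl)
  where
  -- Turning again would revisit `pt x b`, which `p∉qs` forbids.
  ¬return : ∀ {b″ rs} → partner φ b′ ≡ just b″ → qs ≢ pt x b″ ∷ rs
  ¬return b′↔b″ refl =
    All.head p∉qs (cong (pt x) (sym (partner-involutive φ b b↔b′ b′↔b″)))

-- The ban along the left side and the final count

vertical-abscissa : ∀ {p q} → Up p q ⊎ Down p q → proj₁ q ≡ proj₁ p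
vertical-abscissa (inj₁ refl) = refl
vertical-abscissa (inj₂ refl) = refl

climb⇒vertical : ∀ d {x} b {b′} → climb d b ≡ just b′ →
  Up (pt x b) (pt x b′) ⊎ Down (pt x b) (pt x b′)
climb⇒vertical up   b eq = inj₁ (climb-Move up b eq)
climb⇒vertical down b eq = inj₂ (climb-Move down b eq)

BanOnLeftSide : List Point → Set
BanOnLeftSide = Linked (λ p q → ¬ VerticalOnLeftSide p q)

AtLeast1⇒Ban : ∀ {ps} → All (AtLeast 1) ps → BanOnLeftSide ps
AtLeast1⇒Ban []                         = []
AtLeast1⇒Ban (_ ∷ [])                   = [-]
AtLeast1⇒Ban (ℤ.+≤+ (s≤s _) ∷ q≥ ∷ ps≥) = (λ { (_ , ()) }) ∷ AtLeast1⇒Ban (q≥ ∷ ps≥)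

Leaving⇒Ban : ∀ φ b n {qs} → Leaving φ 0 b n qs → All (AtLeast 1) qs → BanOnLeftSide (pt 0 b ∷ qs)
Leaving⇒Ban φ b zero    refl           _   = [-]
Leaving⇒Ban φ b (suc n) (_ , _ , refl) qs≥ =
  -- The first step raises the abscissa from 0 to 1, so it is not vertical; all later steps start
  -- off the left side.
  (λ { (v , _) → contradiction (vertical-abscissa {pt 0 b} v) λ () }) ∷ AtLeast1⇒Ban qs≥

Starting⇔Connects : ∀ t φ m → Heads t φ (pt 0 0F) → ∀ ps →
  (∃[ b ] Starting φ b m ps) ⇔ Connects t (suc m) 3 ps
Starting⇔Connects t φ m h ps = mk⇔ to from
  where
  to : ∀ {ps} → ∃[ b ] Starting φ b m ps → Connects t (suc m) 3 ps
  to (b , _ , l , refl) =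
    let (path , inside , end) , qs≥ = Leaving⇒Valid t φ 0 b m h refl l
    in path , (b , refl) , end , inside , Leaving⇒Ban φ b m l qs≥

  ¬vertical : ∀ {b b′ qs rs} → BanOnLeftSide (pt 0 b ∷ qs) →
    partner φ b ≡ just b′ → qs ≢ pt 0 b′ ∷ rs
  ¬vertical {b} (¬v ∷ _) b↔b′ refl = ¬v (climb⇒vertical (heading φ b) b b↔b′ , refl)

  from : ∀ {ps} → Connects t (suc m) 3 ps → ∃[ b ] Starting φ b m ps
  from {_ ∷ qs} (path , (b , refl) , end , inside , ban) =
    b , qs , Valid⇒Leaving t φ 0 b m qs h refl (¬vertical ban) (path , inside , end) , refl

brickWallCount : ∀ t φ m → Heads t φ (pt 0 0F) → 𝓑[ t ] suc m , 3 ≔ F (suc m + 3)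
brickWallCount t φ m h = subst (HasCardinality _) (#Starting φ m)
  (HasCardinality-⇔ (Starting⇔Connects t φ m h) (∃Starting-card φ m))

corollary3p2 : ∀ (l : ℕ) → l ≥ 1 →
    (𝓑[ first ] l , 3 ≔ F (l + 3)) × (𝓑[ second ] l , 3 ≔ F (l + 3))
corollary3p2 (suc m) _ =
  -- The origin is even, so it heads up for the first type and down for the second.
  brickWallCount first up m (2 ∣0) , brickWallCount second down m (2 ∣0)
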